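{- Let $d\ge 2$ be an integer. Let $H$ be a connected graph with maximum degree $d$ and $N$ vertices, where $N>d^{d^{d^d}}$, and let $U_+,U_-\subseteq V(H)$ be disjoint. Then there exists a graph $G$ such that $N\le|V(G)|\le 2^{d^{21d+20}}N$, the maximum degree of $G$ is at most $d\,2^{d^{21d+20}}$, and there are at least $2^{|V(G)|/2^{d^{21d+20}}}$ sets $S\subseteq V(G)$ such that $G[S]$ is a maximal $(U_+,U_-)$-prescribed induced blow-up of $H$.
   Context: All graphs are finite and simple. With $V(H)=\{1,\dots,k\}$, a $(U_+,U_-)$-prescribed induced blow-up of $H$ is a graph whose vertex set is partitioned into nonempty sets $V_1\sqcup\dots\sqcup V_k$ such that for $i\neq j$, $V_i$ is complete to $V_j$ if $ij\in E(H)$ and there are no edges between $V_i$ and $V_j$ if $ij\notin E(H)$; moreover $V_i$ is a clique for $i\in U_+$ and an independent set for $i\in U_-$. For $S\subseteq V(G)$, $G[S]$ is a maximal such blow-up if $G[S]$ is one and there is no $S'$ with $S\subsetneq S'\subseteq V(G)$ such that $G[S']$ is one. -}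

module Defs where

open import Data.Nat using (ℕ; zero; suc; _+_; _*_; _^_; _≤_)
open import Data.Bool using (Bool; true; false; if_then_else_)
open import Data.Fin using (Fin)
open import Data.Fin.Subset using (Subset; _∈_; _⊂_)
open import Data.List using (List; map; allFin)
open import Data.Nat.ListAction using (sum)
open import Data.Product using (Σ; ∃; ∃-syntax; _×_; _,_)
open import Relation.Binary.PropositionalEquality using (_≡_; _≢_)
open import Relation.Nullary using (¬_)

record Graph (n : ℕ) : Set where
  field
    adj   : Fin n → Fin n → Bool
    sym   : ∀ u v → adj u v ≡ adj v u
    irrefl : ∀ v → adj v v ≡ false
open Graph public

deg : ∀ {n} → Graph n → Fin n → ℕ
deg {n} G v = sum (map (λ u → if adj G v u then 1 else 0) (allFin n))

MaxDegree≤ : ∀ {n} → Graph n → ℕ → Set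
MaxDegree≤ {n} G D = ∀ (v : Fin n) → deg G v ≤ D

MaxDegree : ∀ {n} → Graph n → ℕ → Set
MaxDegree {n} G D = MaxDegree≤ G D × ∃[ v ] deg G v ≡ D

data Walk {n : ℕ} (G : Graph n) : Fin n → Fin n → Set where
  here : ∀ {v} → Walk G v v
  step : ∀ {u v w} → adj G u v ≡ true → Walk G v w → Walk G u w

Connected : ∀ {n} → Graph n → Set
Connected {n} G = ∀ (u v : Fin n) → Walk G u v

Disjoint : ∀ {k} → Subset k → Subset k → Set
Disjoint {k} A B = ∀ (i : Fin k) → ¬ (i ∈ A × i ∈ B)

-- G[S] is a (U₊,U₋)-prescribed induced blow-up of H (V(H) = Fin k):
-- f assigns to each vertex of S its part V_{f v}; the parts are nonempty,
-- distinct parts are complete/anticomplete according to H, and the part V_i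
-- is a clique for i ∈ U₊ and an independent set for i ∈ U₋.
-- (Values of f outside S are irrelevant.)
IsBlowup : ∀ {n k} → Graph n → Graph k → Subset k → Subset k → Subset n → Set
IsBlowup {n} {k} G H U₊ U₋ S =
  Σ (Fin n → Fin k) λ f →
    (∀ (i : Fin k) → ∃[ v ] (v ∈ S × f v ≡ i))
    × (∀ (u v : Fin n) → u ∈ S → v ∈ S → f u ≢ f v → adj G u v ≡ adj H (f u) (f v))
    × (∀ (u v : Fin n) → u ∈ S → v ∈ S → u ≢ v → f u ≡ f v → f u ∈ U₊ → adj G u v ≡ true)
    × (∀ (u v : Fin n) → u ∈ S → v ∈ S → u ≢ v → f u ≡ f v → f u ∈ U₋ → adj G u v ≡ false)

IsMaximalBlowup : ∀ {n k} → Graph n → Graph k → Subset k → Subset k → Subset n → Set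
IsMaximalBlowup G H U₊ U₋ S =
  IsBlowup G H U₊ U₋ S × (∀ S' → S ⊂ S' → ¬ IsBlowup G H U₊ U₋ S')

{-# OPTIONS --safe #-}
-- Double every vertex of H into layers 0 and 1, joining two copies whenever their
-- originals are adjacent.  Greedily pick m blocks of d + 2 vertices y₀, …, y_{d+1} of H, all
-- picked vertices being at pairwise distance at least 3, and in each block add the edges from
-- y₀ in layer 1 to y₁, …, y_{d+1} in layer 0.  Choosing one layer per block gives 2 ^ m induced
-- copies of H.  If two choices differ at a block, the union of the two copies contains a spider:
-- the hub y₀ in layer 1, its d + 1 spokes y₁, …, y_{d+1} in layer 0, and a private neighbour
-- zᵢ of each spoke.  A spider lies in no blow-up of H: as soon as two of the vertices
-- y₀, …, y_{d+1} share a part, the whole spider is in that part, so that some vertex is adjacent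
-- to all the zᵢ and its original has d + 1 neighbours in H; otherwise the part of the hub has
-- degree at least d + 1 in H.  Hence extending the 2 ^ m copies to maximal blow-ups keeps them distinct.
module Submission where

open import Defs
open import Data.Nat using (ℕ; _+_; _*_; _^_; _≤_; _<_)
open import Data.Fin.Subset using (Subset)
open import Data.List using (List; length)
open import Data.List.Relation.Unary.All using (All)
open import Data.List.Relation.Unary.Unique.Propositional using (Unique)
open import Data.Product using (Σ; ∃; ∃-syntax; _×_)

open import Data.Bool using (Bool; true; false; _∨_; if_then_else_)
import Data.Bool.Properties as Bool
open import Data.Empty using (⊥)
open import Data.Fin using (Fin; zero; suc; combine; remQuot; finToFun; funToFin)
open import Data.Fin.Patterns using (0F; 1F)
open import Data.Fin.Properties as Fin
  using (_≟_; any?; all?; injective⇒≤; ¬∀⟶∃¬; combine-injective; combine-remQuot;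
         remQuot-combine; finToFun-funToFin; funToFin-finToFin)
open import Data.Fin.Subset using (_∈_; _⊆_; _⊂_; ∣_∣)
open import Data.Fin.Subset.Properties
  using (_∈?_; _⊂?_; anySubset?; ∣p∣≤n; p⊂q⇒∣p∣<∣q∣; ⊆-refl; ⊆-trans)
open import Data.List using ([]; _∷_; _++_; map; filter; concatMap; allFin; lookup)
open import Data.List.Membership.DecPropositional using () renaming (_∈?_ to decMember)
open import Data.List.Membership.Propositional using () renaming (_∈_ to _∈ₗ_; _∉_ to _∉ₗ_)
open import Data.List.Membership.Propositional.Properties
  using (∈-filter⁺; ∈-filter⁻; ∈-allFin; ∈-lookup; ∈-map⁺; ∈-++⁺ˡ; ∈-++⁺ʳ; ∈-concatMap⁺)
open import Data.List.Properties using (length-++; length-map; length-tabulate)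
import Data.List.Relation.Unary.All as All
import Data.List.Relation.Unary.All.Properties as All
open import Data.List.Relation.Unary.AllPairs using (_∷_)
open import Data.List.Relation.Unary.Any as Any using (here; there; index)
open import Data.List.Relation.Unary.Any.Properties using (lookup-index)
open import Data.List.Relation.Unary.Unique.Propositional.Properties
  using (map⁺; allFin⁺; filter⁺)
open import Data.Maybe using (Maybe; just; nothing)
open import Data.Nat using (zero; suc; z≤n; s≤s; NonZero; >-nonZero; _/_; _%_)
open import Data.Nat.DivMod using (m≡m%n+[m/n]*n; m%n<n; m/n*n≤m; m≥n⇒m/n>0)
open import Data.Nat.ListAction using (sum)
open import Data.Nat.Properties as ℕ using (module ≤-Reasoning)
open import Data.Nat.Tactic.RingSolver using (solve-∀)
open import Data.Product using (_,_; proj₁; proj₂; map₂)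
open import Data.Sum using (_⊎_; inj₁; inj₂)
import Data.Vec as Vec
open import Data.Vec.Functional using () renaming (_∷_ to _∷ᶠ_)
open import Data.Vec.Properties using ([]=⇒lookup; lookup⇒[]=; lookup∘tabulate)
open import Function using (_∘_; id)
open import Function.Definitions using (Injective)
open import Relation.Binary.PropositionalEquality as ≡
  using (_≡_; _≢_; refl; cong; cong₂; subst; subst₂; _≗_)
open import Relation.Nullary using (Dec; yes; no; ¬_; does; contradiction)
open import Relation.Nullary.Decidable using (map′; _×-dec_; _→-dec_; ¬?; dec-true; dec-false)

-- Booleans, lists and counting by injections.

private
  variable
    A B : Set
    k m n : ℕ

∨-true : ∀ a {b} → a ∨ b ≡ true → a ≡ true ⊎ b ≡ true
∨-true true  _ = inj₁ refl
∨-true false p = inj₂ p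

∨-introʳ : ∀ a {b} → b ≡ true → a ∨ b ≡ true
∨-introʳ a refl = Bool.∨-zeroʳ a

true≢false : ∀ {b} → b ≡ true → b ≡ false → ⊥
true≢false refl ()

lookup-injective : {xs : List A} → Unique xs → Injective _≡_ _≡_ (lookup xs)
lookup-injective {xs = _ ∷ _}  _         {zero}  {zero}  _  = refl
lookup-injective {xs = _ ∷ xs} (x∉ ∷ _)  {zero}  {suc j} eq =
  contradiction eq (All.lookup x∉ (∈-lookup {xs = xs} j))
lookup-injective {xs = _ ∷ xs} (x∉ ∷ _)  {suc i} {zero}  eq =
  contradiction (≡.sym eq) (All.lookup x∉ (∈-lookup {xs = xs} i))
lookup-injective {xs = _ ∷ _}  (_ ∷ u)   {suc i} {suc j} eq = cong suc (lookup-injective u eq)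

injective⇒≤length : {f : Fin k → A} → Injective _≡_ _≡_ f →
  (xs : List A) → (∀ i → f i ∈ₗ xs) → k ≤ length xs
injective⇒≤length {f = f} f-inj xs f∈ = injective⇒≤ index-inj
  where
  index-inj : Injective _≡_ _≡_ (λ i → index (f∈ i))
  index-inj {i} {j} eq = f-inj (begin
    f i                        ≡⟨ lookup-index (f∈ i) ⟩
    lookup xs (index (f∈ i))   ≡⟨ cong (lookup xs) eq ⟩
    lookup xs (index (f∈ j))   ≡⟨ lookup-index (f∈ j) ⟨
    f j                        ∎)
    where open ≡.≡-Reasoning

length-concatMap-≤ : (f : A → List B) (b : ℕ) → (∀ x → length (f x) ≤ b) →
  ∀ xs → length (concatMap f xs) ≤ length xs * b
length-concatMap-≤ f b f≤ []       = z≤n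
length-concatMap-≤ f b f≤ (x ∷ xs) = begin
  length (f x ++ concatMap f xs)           ≡⟨ length-++ (f x) ⟩
  length (f x) + length (concatMap f xs)   ≤⟨ ℕ.+-mono-≤ (f≤ x) (length-concatMap-≤ f b f≤ xs) ⟩
  b + length xs * b                        ∎
  where open ≤-Reasoning

∃-∉ : (xs : List (Fin n)) → length xs < n → ∃[ v ] v ∉ₗ xs
∃-∉ {n} xs short = ¬∀⟶∃¬ n (_∈ₗ xs) (λ v → decMember _≟_ v xs)
  (λ all∈ → ℕ.<⇒≱ short (injective⇒≤length id xs all∈))

-- Neighbourhoods, degrees and vertices far apart.

nbrs : Graph n → Fin n → List (Fin n)
nbrs {n} G v = filter (λ u → adj G v u Bool.≟ true) (allFin n)

module _ (G : Graph n) where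

  ∈-nbrs⁺ : ∀ {v u} → adj G v u ≡ true → u ∈ₗ nbrs G v
  ∈-nbrs⁺ {u = u} = ∈-filter⁺ (λ u → adj G _ u Bool.≟ true) (∈-allFin u)

  deg≡length-nbrs : ∀ v → deg G v ≡ length (nbrs G v)
  deg≡length-nbrs v = go (allFin n)
    where
    go : ∀ xs → sum (map (λ u → if adj G v u then 1 else 0) xs)
              ≡ length (filter (λ u → adj G v u Bool.≟ true) xs)
    go []       = refl
    go (u ∷ xs) with adj G v u
    ... | true  = cong suc (go xs)
    ... | false = go xs

  deg≤length : ∀ v (xs : List (Fin n)) → (∀ u → adj G v u ≡ true → u ∈ₗ xs) → deg G v ≤ length xs
  deg≤length v xs cover = subst (_≤ length xs) (≡.sym (deg≡length-nbrs v))
    (injective⇒≤length (lookup-injective (filter⁺ adj? (allFin⁺ n))) xs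
      (λ i → cover _ (proj₂ (∈-filter⁻ adj? {xs = allFin n} (∈-lookup {xs = nbrs G v} i)))))
    where adj? = λ u → adj G v u Bool.≟ true

  injective⇒≤deg : ∀ {v} {f : Fin k → Fin n} → Injective _≡_ _≡_ f →
    (∀ i → adj G v (f i) ≡ true) → k ≤ deg G v
  injective⇒≤deg {v = v} f-inj v~f = subst (_ ≤_) (≡.sym (deg≡length-nbrs v))
    (injective⇒≤length f-inj (nbrs G v) (∈-nbrs⁺ ∘ v~f))

  adj-swap : ∀ {u v b} → adj G u v ≡ b → adj G v u ≡ b
  adj-swap {u} {v} = ≡.trans (sym G v u)

  -- A walk to a different vertex cannot be empty, so its first edge gives the neighbour.
  Connected⇒∃nbr : 2 ≤ n → Connected G → ∀ v → ∃[ w ] adj G v w ≡ true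
  Connected⇒∃nbr (s≤s (s≤s _)) conn v = firstStep (other v)
    where
    other : ∀ (v : Fin (suc (suc m))) → ∃[ w ] v ≢ w
    other zero    = suc zero , λ ()
    other (suc v) = zero , λ ()
    firstStep : ∃[ w ] v ≢ w → ∃[ w ] adj G v w ≡ true
    firstStep (w , v≢w) with conn v w
    ... | here         = contradiction refl v≢w
    ... | step v~u _   = _ , v~u

  -- Apart vertices are exactly those at distance at least 3.

  Apart : Fin n → Fin n → Set
  Apart u v = u ≢ v × adj G u v ≡ false × (∀ w → adj G u w ≡ true → adj G v w ≡ false)

  Apart-sym : ∀ {u v} → Apart u v → Apart v u
  Apart-sym (u≢v , u≁v , disj) = u≢v ∘ ≡.sym , adj-swap u≁v ,
    λ w v~w → Bool.¬-not (λ u~w → true≢false v~w (disj w u~w))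

  ball₂ : Fin n → List (Fin n)
  ball₂ v = concatMap (λ w → w ∷ nbrs G w) (v ∷ nbrs G v)

  ∉ball₂⇒Apart : ∀ {u v} → v ∉ₗ ball₂ u → Apart u v
  ∉ball₂⇒Apart {u} {v} v∉ =
      (λ u≡v → v∉ (within (here refl) (here (≡.sym u≡v))))
    , Bool.¬-not (λ u~v → v∉ (within (here refl) (there (∈-nbrs⁺ u~v))))
    , λ w u~w → Bool.¬-not (λ v~w →
        v∉ (within (there (∈-nbrs⁺ u~w)) (there (∈-nbrs⁺ (adj-swap v~w)))))
    where
    within : ∀ {w} → w ∈ₗ u ∷ nbrs G u → v ∈ₗ w ∷ nbrs G w → v ∈ₗ ball₂ u
    within w∈ v∈ = ∈-concatMap⁺ (λ w → w ∷ nbrs G w) (Any.map (λ { refl → v∈ }) w∈)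

  module _ {d : ℕ} (Δ≤d : MaxDegree≤ G d) where

    length-ball₂ : ∀ v → length (ball₂ v) ≤ suc d * suc d
    length-ball₂ v = begin
      length (ball₂ v)                  ≤⟨ length-concatMap-≤ (λ w → w ∷ nbrs G w) (suc d) length-closed (v ∷ nbrs G v) ⟩
      suc (length (nbrs G v)) * suc d   ≤⟨ ℕ.*-monoˡ-≤ (suc d) (length-closed v) ⟩
      suc d * suc d                     ∎
      where
      open ≤-Reasoning
      length-closed : ∀ w → suc (length (nbrs G w)) ≤ suc d
      length-closed w = s≤s (subst (_≤ d) (deg≡length-nbrs w) (Δ≤d w))

    -- Greedy choice: each picked vertex rules out at most `suc d * suc d` vertices, those in its
    -- ball of radius 2, so after `k` picks a vertex outside all these balls remains.
    apartFamily : ∀ k → k * (suc d * suc d) ≤ n →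
      ∃[ y ] (∀ (i j : Fin k) → i ≢ j → Apart (y i) (y j))
    apartFamily zero    _    = (λ ()) , λ ()
    apartFamily (suc k) room = v ∷ᶠ y , apart′
      where
      smaller : Σ (Fin k → Fin n) λ y → ∀ (i j : Fin k) → i ≢ j → Apart (y i) (y j)
      smaller = apartFamily k (ℕ.≤-trans (ℕ.m≤n+m _ (suc d * suc d)) room)
      y = proj₁ smaller
      covered = concatMap (ball₂ ∘ y) (allFin k)
      fresh : ∃[ v ] v ∉ₗ covered
      fresh = ∃-∉ covered (begin-strict
        length covered                        ≤⟨ length-concatMap-≤ (ball₂ ∘ y) _ (length-ball₂ ∘ y) (allFin k) ⟩
        length (allFin k) * (suc d * suc d)   ≡⟨ cong (_* (suc d * suc d)) (length-tabulate {n = k} id) ⟩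
        k * (suc d * suc d)                   <⟨ ℕ.m<n+m _ (s≤s z≤n) ⟩
        suc k * (suc d * suc d)               ≤⟨ room ⟩
        n                                     ∎)
        where open ≤-Reasoning
      v = proj₁ fresh
      apart-v : ∀ i → Apart (y i) v
      apart-v i = ∉ball₂⇒Apart (λ v∈ → proj₂ fresh
        (∈-concatMap⁺ (ball₂ ∘ y) (Any.map (λ { refl → v∈ }) (∈-allFin i))))
      apart′ : ∀ (i j : Fin (suc k)) → i ≢ j → Apart ((v ∷ᶠ y) i) ((v ∷ᶠ y) j)
      apart′ zero    zero    i≢j = contradiction refl i≢j
      apart′ zero    (suc j) _   = Apart-sym (apart-v j)
      apart′ (suc i) zero    _   = apart-v i
      apart′ (suc i) (suc j) i≢j = proj₂ smaller i j (i≢j ∘ cong suc)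

-- Deciding blow-ups and extending them to maximal ones.

-- The search runs over numerical codes of functions. Decoding a code returns the original function
-- only pointwise, hence the condition that `P` respect `≗`.
anyFunction? : {P : (Fin n → Fin k) → Set} → (∀ {f g} → f ≗ g → P f → P g) →
  (∀ f → Dec (P f)) → Dec (∃ P)
anyFunction? resp P? = map′
  (λ (c , p) → finToFun c , p)
  (λ (f , p) → funToFin f , resp (≡.sym ∘ finToFun-funToFin f) p)
  (any? (P? ∘ finToFun))

isBlowup? : (G : Graph n) (H : Graph k) (U₊ U₋ : Subset k) → ∀ S → Dec (IsBlowup G H U₊ U₋ S)
isBlowup? G H U₊ U₋ S = anyFunction?
  (λ f≗g (onto , cross , clq , ind) →
      (λ i → map₂ (map₂ (≡.trans (≡.sym (f≗g _)))) (onto i))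
    , (λ u v u∈ v∈ → subst₂ (λ a b → a ≢ b → adj G u v ≡ adj H a b) (f≗g u) (f≗g v) (cross u v u∈ v∈))
    , (λ u v u∈ v∈ u≢v →
        subst₂ (λ a b → a ≡ b → a ∈ U₊ → adj G u v ≡ true) (f≗g u) (f≗g v) (clq u v u∈ v∈ u≢v))
    , (λ u v u∈ v∈ u≢v →
        subst₂ (λ a b → a ≡ b → a ∈ U₋ → adj G u v ≡ false) (f≗g u) (f≗g v) (ind u v u∈ v∈ u≢v)))
  (λ f →
    all? (λ i → any? λ v → v ∈? S ×-dec f v ≟ i)
    ×-dec (all? λ u → all? λ v → u ∈? S →-dec v ∈? S →-dec ¬? (f u ≟ f v)
             →-dec adj G u v Bool.≟ adj H (f u) (f v))
    ×-dec (all? λ u → all? λ v → u ∈? S →-dec v ∈? S →-dec ¬? (u ≟ v) →-dec f u ≟ f v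
             →-dec f u ∈? U₊ →-dec adj G u v Bool.≟ true)
    ×-dec (all? λ u → all? λ v → u ∈? S →-dec v ∈? S →-dec ¬? (u ≟ v) →-dec f u ≟ f v
             →-dec f u ∈? U₋ →-dec adj G u v Bool.≟ false))

-- Pass to a strictly larger set with `P` as long as there is one. The fuel bounds the number of
-- vertices still outside the set; when it is zero the set is everything.
extendToMaximal : {P : Subset n → Set} → (∀ S → Dec (P S)) → ∀ {S} → P S →
  ∃[ T ] (S ⊆ T × P T × (∀ S' → T ⊂ S' → ¬ P S'))
extendToMaximal {n} {P} P? {S} = go n (ℕ.m≤m+n n ∣ S ∣)
  where
  go : ∀ fuel {S} → n ≤ fuel + ∣ S ∣ → P S → ∃[ T ] (S ⊆ T × P T × (∀ S' → T ⊂ S' → ¬ P S'))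
  go zero {S} n≤ pS = S , ⊆-refl , pS , λ S' S⊂S' _ →
    ℕ.<⇒≱ (p⊂q⇒∣p∣<∣q∣ S⊂S') (ℕ.≤-trans (∣p∣≤n S') n≤)
  go (suc fuel) {S} n≤ pS with anySubset? (λ S' → S ⊂? S' ×-dec P? S')
  ... | no  none              = S , ⊆-refl , pS , λ S' S⊂S' pS' → none (S' , S⊂S' , pS')
  ... | yes (S' , S⊂S' , pS') =
    let T , S'⊆T , pT , max = go fuel room pS' in T , ⊆-trans (proj₁ S⊂S') S'⊆T , pT , max
    where
    room : n ≤ fuel + ∣ S' ∣
    room = begin
      n                    ≤⟨ n≤ ⟩
      suc (fuel + ∣ S ∣)   ≡⟨ ℕ.+-suc fuel ∣ S ∣ ⟨
      fuel + suc ∣ S ∣     ≤⟨ ℕ.+-monoʳ-≤ fuel (p⊂q⇒∣p∣<∣q∣ S⊂S') ⟩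
      fuel + ∣ S' ∣        ∎
      where open ≤-Reasoning

-- Spiders lie in no blow-up of H.

record Spider (G : Graph n) (k : ℕ) (S : Subset n) : Set where
  field
    hub       : Fin n
    spoke tip : Fin k → Fin n
    hub∈      : hub ∈ S
    spoke∈    : ∀ i → spoke i ∈ S
    tip∈      : ∀ i → tip i ∈ S
    spoke~hub : ∀ i → adj G (spoke i) hub ≡ true
    tip~spoke : ∀ i → adj G (tip i) (spoke i) ≡ true
    tip≁hub   : ∀ i → adj G (tip i) hub ≡ false
    spoke≁    : ∀ {i j} → i ≢ j → adj G (spoke i) (spoke j) ≡ false
    tip≁spoke : ∀ {i j} → i ≢ j → adj G (tip i) (spoke j) ≡ false
    tips-undominated : ∀ w → ¬ (∀ i → adj G w (tip i) ≡ true)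

¬IsBlowup-Spider : ∀ {G : Graph n} {H : Graph k} {U₊ U₋ S d} →
  MaxDegree≤ H d → (∀ v → ∃[ w ] adj H v w ≡ true) →
  Spider G (suc d) S → ¬ IsBlowup G H U₊ U₋ S
¬IsBlowup-Spider {G = G} {H = H} {S = S} {d = d} Δ≤d ∃nbr spider (f , onto , cross , _) =
  ℕ.<⇒≱ (injective⇒≤deg H spokes-inj hub~spokes) (Δ≤d (f hub))
  where
  open Spider spider

  -- Vertices of one part look alike from any other part, so a vertex of `S` that distinguishes two
  -- members of a part belongs to that part.
  absorb : ∀ {u v w} → u ∈ S → v ∈ S → w ∈ S → f u ≡ f v →
    adj G w u ≡ true → adj G w v ≡ false → f w ≡ f u
  absorb {u} {v} {w} u∈ v∈ w∈ fu≡fv w~u w≁v with f w ≟ f u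
  ... | yes eq = eq
  ... | no neq = contradiction w≁v (true≢false (begin
    adj G w v           ≡⟨ cross w v w∈ v∈ (λ e → neq (≡.trans e (≡.sym fu≡fv))) ⟩
    adj H (f w) (f v)   ≡⟨ cong (adj H (f w)) fu≡fv ⟨
    adj H (f w) (f u)   ≡⟨ cross w u w∈ u∈ neq ⟨
    adj G w u           ≡⟨ w~u ⟩
    true                ∎))
    where open ≡.≡-Reasoning

  -- Otherwise every further spoke distinguishes the hub from spoke `i` and joins their part; then
  -- each tip distinguishes its spoke from the hub and joins too. A vertex from a neighbouring part
  -- is then adjacent to all tips.
  hub≢spoke : ∀ i → f hub ≢ f (spoke i)
  hub≢spoke i hub≡spoke = tips-undominated _ dominates
    where
    spokes : ∀ j → f (spoke j) ≡ f hub
    spokes j with i ≟ j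
    ... | yes refl = ≡.sym hub≡spoke
    ... | no  i≢j  = absorb hub∈ (spoke∈ i) (spoke∈ j) hub≡spoke (spoke~hub j) (spoke≁ (i≢j ∘ ≡.sym))
    tips : ∀ j → f (tip j) ≡ f hub
    tips j = ≡.trans
      (absorb (spoke∈ j) hub∈ (tip∈ j) (spokes j) (tip~spoke j) (tip≁hub j)) (spokes j)
    w~hub : let w , _ = onto (proj₁ (∃nbr (f hub))) in adj H (f w) (f hub) ≡ true
    w~hub = let q , hub~q = ∃nbr (f hub) ; _ , _ , fw≡q = onto q in
      subst (λ a → adj H a (f hub) ≡ true) (≡.sym fw≡q) (adj-swap H hub~q)
    dominates : let w , _ = onto (proj₁ (∃nbr (f hub))) in ∀ j → adj G w (tip j) ≡ true
    dominates j = let w , w∈ , _ = onto (proj₁ (∃nbr (f hub))) in ≡.trans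
      -- `w` is in another part than the tips, as otherwise `f hub` would be adjacent to itself in
      -- H.
      (cross w (tip j) w∈ (tip∈ j) λ e → true≢false w~hub
        (≡.trans (cong (λ a → adj H a (f hub)) (≡.trans e (tips j))) (irrefl H (f hub))))
      (≡.trans (cong (adj H (f w)) (tips j)) w~hub)

  -- If two spokes share a part, the tip of the first distinguishes them and joins it; the hub then
  -- distinguishes that spoke from its tip, and joining them contradicts `hub≢spoke`.
  spokes-inj : Injective _≡_ _≡_ (f ∘ spoke)
  spokes-inj {i} {j} eq with i ≟ j
  ... | yes i≡j = i≡j
  ... | no  i≢j = contradiction
    (absorb (spoke∈ i) (tip∈ i) hub∈ (≡.sym tip≡spoke) (adj-swap G (spoke~hub i)) (adj-swap G (tip≁hub i)))
    (hub≢spoke i)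
    where
    tip≡spoke : f (tip i) ≡ f (spoke i)
    tip≡spoke = absorb (spoke∈ i) (spoke∈ j) (tip∈ i) eq (tip~spoke i) (tip≁spoke i≢j)

  hub~spokes : ∀ i → adj H (f hub) (f (spoke i)) ≡ true
  hub~spokes i = ≡.trans (≡.sym (cross hub (spoke i) hub∈ (spoke∈ i) (hub≢spoke i)))
    (adj-swap G (spoke~hub i))

-- The graph G: two layers of H with hub-spoke edges in each block.

module Construction {N : ℕ} (H : Graph N) {d : ℕ} (Δ≤d : MaxDegree≤ H d)
  (∃nbr : ∀ v → ∃[ w ] adj H v w ≡ true) (m : ℕ)
  (y : Fin (m * (2 + d)) → Fin N) (apart : ∀ i j → i ≢ j → Apart H (y i) (y j)) where

  -- A block and a position in it: position `zero` is the hub, each `suc i` is a spoke.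
  Label : Set
  Label = Fin m × Fin (2 + d)

  member : Fin m → Fin (2 + d) → Fin N
  member j i = y (combine j i)

  y-injective : Injective _≡_ _≡_ y
  y-injective {k} {l} eq with k ≟ l
  ... | yes k≡l = k≡l
  ... | no  k≢l = contradiction eq (proj₁ (apart k l k≢l))

  apart-members : ∀ {j j' i i'} → i ≢ i' → Apart H (member j i) (member j' i')
  apart-members {j} {j'} {i} {i'} i≢i' =
    apart _ _ (i≢i' ∘ proj₂ ∘ combine-injective j i j' i')

  label : Fin N → Maybe Label
  label v with any? (λ k → y k ≟ v)
  ... | yes (k , _) = just (remQuot (2 + d) k)
  ... | no  _       = nothing

  label-y : ∀ k → label (y k) ≡ just (remQuot (2 + d) k)
  label-y k with any? (λ l → y l ≟ y k)
  ... | yes (l , yl≡yk) = cong (just ∘ remQuot (2 + d)) (y-injective yl≡yk)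
  ... | no  none        = contradiction (k , refl) none

  label-member : ∀ j i → label (member j i) ≡ just (j , i)
  label-member j i = ≡.trans (label-y (combine j i)) (cong just (remQuot-combine j i))

  label-just : ∀ {v j i} → label v ≡ just (j , i) → v ≡ member j i
  label-just {v} eq with any? (λ k → y k ≟ v)
  label-just refl | yes (k , refl) = cong y (≡.sym (combine-remQuot {m} (2 + d) k))

  -- The added edges, directed from hub to spoke; `G` symmetrises them. Only layers and labels
  -- enter, so finite case analysis settles every property.
  hubSpoke : Fin 2 × Maybe Label → Fin 2 × Maybe Label → Bool
  hubSpoke (1F , just (j , zero)) (0F , just (j' , suc _)) = does (j ≟ j')
  hubSpoke _                      _                        = false

  hubSpoke-irrefl : ∀ s → hubSpoke s s ≡ false
  hubSpoke-irrefl (0F , _)                = refl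
  hubSpoke-irrefl (1F , just (_ , zero))  = refl
  hubSpoke-irrefl (1F , just (_ , suc _)) = refl
  hubSpoke-irrefl (1F , nothing)          = refl

  SameBlock : Maybe Label → Maybe Label → Set
  SameBlock l l' = ∃[ j ] ∃[ i ] ∃[ i' ] (l ≡ just (j , i) × l' ≡ just (j , i'))

  SameBlock-sym : ∀ {l l'} → SameBlock l l' → SameBlock l' l
  SameBlock-sym (j , i , i' , p , q) = j , i' , i , q , p

  hubSpoke⇒SameBlock : ∀ s s' → hubSpoke s s' ≡ true → SameBlock (proj₂ s) (proj₂ s')
  hubSpoke⇒SameBlock (1F , just (j , zero)) (0F , just (j' , suc i)) eq with j ≟ j'
  ... | yes refl = j , zero , suc i , refl , refl

  π : Fin (N * 2) → Fin N
  π x = proj₁ (remQuot {N} 2 x)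

  layer : Fin (N * 2) → Fin 2
  layer x = proj₂ (remQuot {N} 2 x)

  state : Fin (N * 2) → Fin 2 × Maybe Label
  state x = layer x , label (π x)

  combine-π-layer : ∀ x → combine (π x) (layer x) ≡ x
  combine-π-layer = combine-remQuot {N} 2

  π-combine : ∀ v (a : Fin 2) → π (combine v a) ≡ v
  π-combine v a = cong proj₁ (remQuot-combine v a)

  layer-combine : ∀ (v : Fin N) a → layer (combine v a) ≡ a
  layer-combine v a = cong proj₂ (remQuot-combine v a)

  state-member : ∀ a j i → state (combine (member j i) a) ≡ (a , just (j , i))
  state-member a j i = cong₂ _,_ (layer-combine (member j i) a)
    (≡.trans (cong label (π-combine (member j i) a)) (label-member j i))

  G : Graph (N * 2)
  G = record
    { adj    = λ x x' → adj H (π x) (π x') ∨ (hubSpoke (state x) (state x') ∨ hubSpoke (state x') (state x))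
    ; sym    = λ x x' → cong₂ _∨_ (sym H (π x) (π x')) (Bool.∨-comm (hubSpoke (state x) (state x')) _)
    ; irrefl = λ x → cong₂ _∨_ (irrefl H (π x))
                 (cong₂ _∨_ (hubSpoke-irrefl (state x)) (hubSpoke-irrefl (state x)))
    }

  adjG≡adjH : ∀ {x x'} → hubSpoke (state x) (state x') ≡ false → hubSpoke (state x') (state x) ≡ false →
    adj G x x' ≡ adj H (π x) (π x')
  adjG≡adjH {x} {x'} p q =
    ≡.trans (cong₂ (λ a b → adj H (π x) (π x') ∨ (a ∨ b)) p q) (Bool.∨-identityʳ _)

  blockOf : Maybe Label → List (Fin N)
  blockOf nothing        = []
  blockOf (just (j , _)) = map (member j) (allFin (2 + d))

  length-blockOf : ∀ l → length (blockOf l) ≤ 2 + d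
  length-blockOf nothing        = z≤n
  length-blockOf (just (j , _)) = ℕ.≤-reflexive
    (≡.trans (length-map (member j) (allFin (2 + d))) (length-tabulate {n = 2 + d} id))

  -- A neighbour of `x` lies above one of the at most `d` neighbours of `π x` in H or above one of
  -- the `2 + d` members of its block; the factor 2 counts the layers.
  Δ-G : MaxDegree≤ G ((d + (2 + d)) * 2)
  Δ-G x = begin
    deg G x                   ≤⟨ deg≤length G x cover covers ⟩
    length cover              ≤⟨ length-concatMap-≤ fibre 2 (λ _ → ℕ.≤-refl) below ⟩
    length below * 2          ≡⟨ cong (_* 2) (length-++ (nbrs H (π x))) ⟩
    (length (nbrs H (π x)) + length (blockOf (label (π x)))) * 2
      ≤⟨ ℕ.*-monoˡ-≤ 2 (ℕ.+-mono-≤ (subst (_≤ d) (deg≡length-nbrs H (π x)) (Δ≤d (π x)))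
                                   (length-blockOf (label (π x)))) ⟩
    (d + (2 + d)) * 2         ∎
    where
    open ≤-Reasoning
    fibre : Fin N → List (Fin (N * 2))
    fibre v = map (combine v) (allFin 2)
    below = nbrs H (π x) ++ blockOf (label (π x))
    cover = concatMap fibre below
    lift : ∀ x' → π x' ∈ₗ below → x' ∈ₗ cover
    lift x' = ∈-concatMap⁺ fibre ∘ Any.map (λ { refl →
      subst (_∈ₗ fibre (π x')) (combine-π-layer x') (∈-map⁺ (combine (π x')) (∈-allFin (layer x'))) })
    inBlock : ∀ l l' {v} → label v ≡ l' → SameBlock l l' → v ∈ₗ blockOf l
    inBlock _ _ eq (j , i , i' , refl , refl) =
      subst (_∈ₗ map (member j) (allFin (2 + d))) (≡.sym (label-just eq)) (∈-map⁺ (member j) (∈-allFin i'))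
    sameBlock : ∀ x' → hubSpoke (state x) (state x') ≡ true ⊎ hubSpoke (state x') (state x) ≡ true →
      SameBlock (label (π x)) (label (π x'))
    sameBlock x' (inj₁ p) = hubSpoke⇒SameBlock (state x) (state x') p
    sameBlock x' (inj₂ p) = SameBlock-sym (hubSpoke⇒SameBlock (state x') (state x) p)
    covers : ∀ x' → adj G x x' ≡ true → x' ∈ₗ cover
    covers x' x~x' with ∨-true (adj H (π x) (π x')) x~x'
    ... | inj₁ e = lift x' (∈-++⁺ˡ (∈-nbrs⁺ H e))
    ... | inj₂ e = lift x' (∈-++⁺ʳ (nbrs H (π x)) (inBlock (label (π x)) (label (π x')) refl
      (sameBlock x' (∨-true (hubSpoke (state x) (state x')) e))))

  -- The copies of H given by choices of layers.

  Choice : Set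
  Choice = Fin m → Fin 2

  -- Unlabelled vertices are always taken from layer 0, so the tips of the spiders lie in every
  -- copy.
  layerOf : Choice → Maybe Label → Fin 2
  layerOf σ nothing        = 0F
  layerOf σ (just (j , _)) = σ j

  copy : Choice → Subset (N * 2)
  copy σ = Vec.tabulate (λ x → does (layer x ≟ layerOf σ (label (π x))))

  ∈-copy⁺ : ∀ {σ x} → layer x ≡ layerOf σ (label (π x)) → x ∈ copy σ
  ∈-copy⁺ {σ} {x} eq = lookup⇒[]= x (copy σ)
    (≡.trans (lookup∘tabulate _ x) (dec-true (_ ≟ _) eq))

  ∈-copy⁻ : ∀ {σ x} → x ∈ copy σ → layer x ≡ layerOf σ (label (π x))
  ∈-copy⁻ {σ} {x} x∈ with layer x ≟ layerOf σ (label (π x))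
                        | ≡.trans (≡.sym (lookup∘tabulate _ x)) ([]=⇒lookup x∈)
  ... | yes eq | _ = eq

  lift-∈-copy : ∀ σ v → combine v (layerOf σ (label v)) ∈ copy σ
  lift-∈-copy σ v = ∈-copy⁺ (≡.trans (layer-combine v _)
    (cong (layerOf σ ∘ label) (≡.sym (π-combine v (layerOf σ (label v))))))

  -- An added edge joins different layers within one block, whereas a copy takes each block from a
  -- single layer.
  hubSpoke-copy : ∀ σ l l' → hubSpoke (layerOf σ l , l) (layerOf σ l' , l') ≡ false
  hubSpoke-copy σ nothing             _ = refl
  hubSpoke-copy σ (just (j , suc _))  _ with σ j
  ... | 0F = refl
  ... | 1F = refl
  hubSpoke-copy σ (just (j , zero)) nothing with σ j
  ... | 0F = refl
  ... | 1F = refl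
  hubSpoke-copy σ (just (j , zero)) (just (j' , i)) with σ j in σj | σ j' in σj' | i
  ... | 0F | _  | _     = refl
  ... | 1F | 1F | _     = refl
  ... | 1F | 0F | zero  = refl
  ... | 1F | 0F | suc _ = dec-false (j ≟ j') λ { refl → contradiction (≡.trans (≡.sym σj) σj') λ () }

  adj-copy : ∀ {σ x x'} → x ∈ copy σ → x' ∈ copy σ → adj G x x' ≡ adj H (π x) (π x')
  adj-copy {σ} {x} {x'} x∈ x'∈ = adjG≡adjH {x} {x'} (noEdge x∈ x'∈) (noEdge x'∈ x∈)
    where
    noEdge : ∀ {u v} → u ∈ copy σ → v ∈ copy σ → hubSpoke (state u) (state v) ≡ false
    noEdge {u} {v} u∈ v∈ = subst₂ (λ a b → hubSpoke (a , label (π u)) (b , label (π v)) ≡ false)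
      (≡.sym (∈-copy⁻ {σ} u∈)) (≡.sym (∈-copy⁻ {σ} v∈)) (hubSpoke-copy σ (label (π u)) (label (π v)))

  -- A copy meets each fibre of `π` exactly once, so all parts are singletons and the clique and
  -- independence conditions hold vacuously.
  copy-IsBlowup : ∀ U₊ U₋ σ → IsBlowup G H U₊ U₋ (copy σ)
  copy-IsBlowup U₊ U₋ σ = π
    , (λ v → combine v (layerOf σ (label v)) , lift-∈-copy σ v , π-combine v _)
    , (λ u v u∈ v∈ _ → adj-copy {σ} u∈ v∈)
    , (λ u v u∈ v∈ u≢v eq _ → contradiction (π-injective u∈ v∈ eq) u≢v)
    , (λ u v u∈ v∈ u≢v eq _ → contradiction (π-injective u∈ v∈ eq) u≢v)
    where
    open ≡.≡-Reasoning
    π-injective : ∀ {u v} → u ∈ copy σ → v ∈ copy σ → π u ≡ π v → u ≡ v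
    π-injective {u} {v} u∈ v∈ eq = begin
      u                                        ≡⟨ combine-π-layer u ⟨
      combine (π u) (layer u)                  ≡⟨ cong (combine (π u)) (∈-copy⁻ {σ} u∈) ⟩
      combine (π u) (layerOf σ (label (π u)))  ≡⟨ cong (λ a → combine a (layerOf σ (label a))) eq ⟩
      combine (π v) (layerOf σ (label (π v)))  ≡⟨ cong (combine (π v)) (∈-copy⁻ {σ} v∈) ⟨
      combine (π v) (layer v)                  ≡⟨ combine-π-layer v ⟩
      v                                        ∎

  -- A labelled neighbour would be a picked vertex: either the member itself, making a loop, or
  -- another one, which is at distance at least 3.
  privateNbr-unlabelled : ∀ {j i z} → adj H (member j i) z ≡ true → label z ≡ nothing
  privateNbr-unlabelled {j} {i} {z} y~z with label z in eq
  ... | nothing        = refl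
  ... | just (j' , i') with combine j i ≟ combine j' i'
  ...   | yes same = contradiction (irrefl H (member j i)) (true≢false
          (subst (λ v → adj H (member j i) v ≡ true)
            (≡.trans (label-just eq) (≡.sym (cong y same))) y~z))
  ...   | no  diff = contradiction (proj₁ (proj₂ (apart _ _ diff)))
          (true≢false (subst (λ v → adj H (member j i) v ≡ true) (label-just eq) y~z))

  -- The spider formed by two copies that differ at a block.

  module _ {S σ τ j} (σ⊆ : copy σ ⊆ S) (τ⊆ : copy τ ⊆ S) (σj≡0 : σ j ≡ 0F) (τj≡1 : τ j ≡ 1F) where

    private
      z : Fin (suc d) → Fin N
      z i = proj₁ (∃nbr (member j (suc i)))

      y~z : ∀ i → adj H (member j (suc i)) (z i) ≡ true
      y~z i = proj₂ (∃nbr (member j (suc i)))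

      -- Members of a block have no common neighbours, and `z i'` is already a neighbour of the
      -- member at `suc i'`.
      y≁z : ∀ {i i'} → i ≢ suc i' → adj H (member j i) (z i') ≡ false
      y≁z {i} {i'} i≢ = proj₂ (proj₂ (apart-members (i≢ ∘ ≡.sym))) (z i') (y~z i')

      member∈copy : ∀ {ρ a i} → ρ j ≡ a → combine (member j i) a ∈ copy ρ
      member∈copy {ρ} {a} {i} refl = subst (λ l → combine (member j i) (layerOf ρ l) ∈ copy ρ)
        (label-member j i) (lift-∈-copy ρ (member j i))

      hubV : Fin (N * 2)
      hubV = combine (member j zero) 1F

      spokeV tipV : Fin (suc d) → Fin (N * 2)
      spokeV i = combine (member j (suc i)) 0F
      tipV   i = combine (z i) 0F

      label-tip : ∀ i → label (π (tipV i)) ≡ nothing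
      label-tip i = ≡.trans (cong label (π-combine (z i) 0F)) (privateNbr-unlabelled (y~z i))

      tip∈copy : ∀ i → tipV i ∈ copy σ
      tip∈copy i = ∈-copy⁺ (≡.trans (layer-combine (z i) 0F) (cong (layerOf σ) (≡.sym (label-tip i))))

      hubSpoke-nothing : ∀ s s' → proj₂ s' ≡ nothing → hubSpoke s s' ≡ false
      hubSpoke-nothing (0F , _)                (_  , nothing) refl = refl
      hubSpoke-nothing (1F , nothing)          (_  , nothing) refl = refl
      hubSpoke-nothing (1F , just (_ , zero))  (0F , nothing) refl = refl
      hubSpoke-nothing (1F , just (_ , zero))  (1F , nothing) refl = refl
      hubSpoke-nothing (1F , just (_ , suc _)) (_  , nothing) refl = refl

      nothing-hubSpoke : ∀ s s' → proj₂ s ≡ nothing → hubSpoke s s' ≡ false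
      nothing-hubSpoke (0F , _)       _ refl = refl
      nothing-hubSpoke (1F , nothing) _ refl = refl

      adj-tip : ∀ x i → adj G x (tipV i) ≡ adj H (π x) (z i)
      adj-tip x i = ≡.trans
        (adjG≡adjH {x} {tipV i} (hubSpoke-nothing (state x) (state (tipV i)) (label-tip i))
                              (nothing-hubSpoke (state (tipV i)) (state x) (label-tip i)))
        (cong (adj H (π x)) (π-combine (z i) 0F))

      adj-tip-member : ∀ i i' a → adj G (tipV i) (combine (member j i') a) ≡ adj H (member j i') (z i)
      adj-tip-member i i' a = ≡.trans (sym G (tipV i) _) (≡.trans (adj-tip _ i)
        (cong (λ v → adj H v (z i)) (π-combine (member j i') a)))

      hubSpoke-block : ∀ i → hubSpoke (state hubV) (state (spokeV i)) ≡ true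
      hubSpoke-block i = subst₂ (λ s s' → hubSpoke s s' ≡ true)
        (≡.sym (state-member 1F j zero)) (≡.sym (state-member 0F j (suc i))) (dec-true (j ≟ j) refl)

    copies⇒Spider : Spider G (suc d) S
    copies⇒Spider = record
      { hub       = hubV
      ; spoke     = spokeV
      ; tip       = tipV
      ; hub∈      = τ⊆ (member∈copy τj≡1)
      ; spoke∈    = λ i → σ⊆ (member∈copy σj≡0)
      ; tip∈      = λ i → σ⊆ (tip∈copy i)
      ; spoke~hub = λ i → ∨-introʳ (adj H (π (spokeV i)) (π hubV))
                            (∨-introʳ (hubSpoke (state (spokeV i)) (state hubV)) (hubSpoke-block i))
      ; tip~spoke = λ i → ≡.trans (adj-tip-member i (suc i) 0F) (y~z i)
      ; tip≁hub   = λ i → ≡.trans (adj-tip-member i zero 1F) (y≁z λ ())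
      ; spoke≁    = λ {i} {i'} i≢i' → ≡.trans
          (adj-copy {σ} (member∈copy {σ} σj≡0) (member∈copy {σ} σj≡0))
          (≡.trans (cong₂ (adj H) (π-combine (member j (suc i)) 0F) (π-combine (member j (suc i')) 0F))
            (proj₁ (proj₂ (apart-members (i≢i' ∘ Fin.suc-injective)))))
      ; tip≁spoke = λ {i} {i'} i≢i' → ≡.trans (adj-tip-member i (suc i') 0F)
          (y≁z (i≢i' ∘ ≡.sym ∘ Fin.suc-injective))
      -- Adjacency to a tip is adjacency in H to some `z i`, and the `z i` are distinct, so `π w`
      -- would have `suc d` neighbours in H.
      ; tips-undominated = λ w w~tips → ℕ.<⇒≱
          (injective⇒≤deg H z-injective λ i → ≡.trans (≡.sym (adj-tip w i)) (w~tips i)) (Δ≤d (π w))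
      }
      where
      z-injective : Injective _≡_ _≡_ z
      z-injective {i} {i'} eq with i ≟ i'
      ... | yes i≡i' = i≡i'
      ... | no  i≢i' = contradiction (y≁z {suc i} (i≢i' ∘ Fin.suc-injective))
        (true≢false (≡.trans (cong (adj H (member j (suc i))) (≡.sym eq)) (y~z i)))

  -- At a block where the choices differ, the copy using layer 0 supplies spokes and tips and the
  -- other one the hub, so `S` would contain a spider.
  copies-in-blowup : ∀ {U₊ U₋ S} σ τ → IsBlowup G H U₊ U₋ S → copy σ ⊆ S → copy τ ⊆ S → σ ≗ τ
  copies-in-blowup σ τ blowup σ⊆ τ⊆ j with σ j in σj | τ j in τj
  ... | 0F | 0F = refl
  ... | 1F | 1F = refl
  ... | 0F | 1F = contradiction blowup (¬IsBlowup-Spider {H = H} Δ≤d ∃nbr (copies⇒Spider {σ = σ} {τ} σ⊆ τ⊆ σj τj))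
  ... | 1F | 0F = contradiction blowup (¬IsBlowup-Spider {H = H} Δ≤d ∃nbr (copies⇒Spider {σ = τ} {σ} τ⊆ σ⊆ τj σj))

  -- Distinct maximal blow-ups from distinct choices.

  module _ (U₊ U₋ : Subset N) where

    maximalCopy : ∀ σ → ∃[ T ] (copy σ ⊆ T × IsMaximalBlowup G H U₊ U₋ T)
    maximalCopy σ = extendToMaximal (isBlowup? G H U₊ U₋) (copy-IsBlowup U₊ U₋ σ)

    maximalCopyOf : Fin (2 ^ m) → Subset (N * 2)
    maximalCopyOf c = proj₁ (maximalCopy (finToFun c))

    -- If two choices extend to the same maximal blow-up, that set contains both copies, so the
    -- choices agree.
    maximalCopyOf-injective : Injective _≡_ _≡_ maximalCopyOf
    maximalCopyOf-injective {c} {c'} eq =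
      let _ , c⊆  , blowup , _ = maximalCopy (finToFun c)
          _ , c'⊆ , _          = maximalCopy (finToFun c')
      in begin
        c                                 ≡⟨ funToFin-finToFin {m} {2} c ⟨
        funToFin {m} {2} (finToFun c)     ≡⟨ funToFin-cong (copies-in-blowup (finToFun c) (finToFun c')
                                               blowup c⊆ (subst (copy (finToFun c') ⊆_) (≡.sym eq) c'⊆)) ⟩
        funToFin {m} {2} (finToFun c')    ≡⟨ funToFin-finToFin {m} {2} c' ⟩
        c'                                ∎
      where
      open ≡.≡-Reasoning
      funToFin-cong : ∀ {a b} {f g : Fin a → Fin b} → f ≗ g → funToFin f ≡ funToFin g
      funToFin-cong {zero}  f≗g = refl
      funToFin-cong {suc a} f≗g = cong₂ combine (f≗g zero) (funToFin-cong (f≗g ∘ suc))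

    maximalCopies : List (Subset (N * 2))
    maximalCopies = map maximalCopyOf (allFin (2 ^ m))

    maximalCopies-maximal : All (IsMaximalBlowup G H U₊ U₋) maximalCopies
    maximalCopies-maximal = All.map⁺
      (All.universal (λ c → proj₂ (proj₂ (maximalCopy (finToFun c)))) (allFin (2 ^ m)))

    maximalCopies-unique : Unique maximalCopies
    maximalCopies-unique = map⁺ maximalCopyOf-injective (allFin⁺ (2 ^ m))

    length-maximalCopies : length maximalCopies ≡ 2 ^ m
    length-maximalCopies = ≡.trans (length-map maximalCopyOf (allFin (2 ^ m)))
      (length-tabulate {n = 2 ^ m} id)

-- Numerical estimates.

-- Vertices of H consumed by one block: d + 2 balls of radius 2.
blockCost : ℕ → ℕ
blockCost d = (2 + d) * (suc d * suc d)

module _ {d : ℕ} (2≤d : 2 ≤ d) where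

  open ≤-Reasoning

  private instance
    d≢0 : NonZero d
    d≢0 = >-nonZero (ℕ.≤-trans (s≤s z≤n) 2≤d)

  -- The factor 4 is a 2 for the two layers of G times a 2 for rounding down the number of blocks.
  4*blockCost≤d^8 : 4 * blockCost d ≤ d ^ 8
  4*blockCost≤d^8 = begin
    4 * ((2 + d) * (suc d * suc d))               ≤⟨ ℕ.*-monoʳ-≤ 4 (ℕ.*-mono-≤ (ℕ.+-monoˡ-≤ d 2≤d) (ℕ.*-mono-≤ sd≤ sd≤)) ⟩
    4 * ((d + d) * ((d + d) * (d + d)))           ≡⟨ expand d ⟩
    2 ^ 5 * d ^ 3                                 ≤⟨ ℕ.*-monoˡ-≤ (d ^ 3) (ℕ.^-monoˡ-≤ 5 2≤d) ⟩
    d ^ 5 * d ^ 3                                 ≡⟨ ℕ.^-distribˡ-+-* d 5 3 ⟨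
    d ^ 8                                         ∎
    where
    sd≤ : suc d ≤ d + d
    sd≤ = ℕ.+-monoˡ-≤ d (ℕ.≤-trans (s≤s z≤n) 2≤d)
    expand : ∀ d → 4 * ((d + d) * ((d + d) * (d + d))) ≡ 32 * (d * (d * (d * 1)))
    expand = solve-∀

  d^8≤tower : d ^ 8 ≤ d ^ (d ^ (d ^ d))
  d^8≤tower = ℕ.^-monoʳ-≤ d (begin
    8               ≤⟨ ℕ.m≤m+n 8 8 ⟩
    2 ^ (2 ^ 2)     ≤⟨ ℕ.^-monoʳ-≤ 2 (ℕ.^-monoʳ-≤ 2 2≤d) ⟩
    2 ^ (2 ^ d)     ≤⟨ ℕ.^-monoʳ-≤ 2 (ℕ.^-monoˡ-≤ d 2≤d) ⟩
    2 ^ (d ^ d)     ≤⟨ ℕ.^-monoˡ-≤ (d ^ d) 2≤d ⟩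
    d ^ (d ^ d)     ∎)

  d^8≤2^d^[21d+20] : d ^ 8 ≤ 2 ^ (d ^ (21 * d + 20))
  d^8≤2^d^[21d+20] = begin
    d ^ 8                     ≤⟨ ℕ.^-monoˡ-≤ 8 (n≤2^n d) ⟩
    (2 ^ d) ^ 8               ≡⟨ ℕ.^-*-assoc 2 d 8 ⟩
    -- The exponent 8 is read as `2 ^ 3`, at most `d ^ 3`, which merges with `d` into `d ^ 4`.
    2 ^ (d * 2 ^ 3)           ≤⟨ ℕ.^-monoʳ-≤ 2 (ℕ.*-monoʳ-≤ d (ℕ.^-monoˡ-≤ 3 2≤d)) ⟩
    2 ^ (d ^ 4)               ≤⟨ ℕ.^-monoʳ-≤ 2 (ℕ.^-monoʳ-≤ d (ℕ.≤-trans (ℕ.m≤m+n 4 16) (ℕ.m≤n+m 20 (21 * d)))) ⟩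
    2 ^ (d ^ (21 * d + 20))   ∎
    where
    n≤2^n : ∀ n → n ≤ 2 ^ n
    n≤2^n zero    = z≤n
    n≤2^n (suc n) = ℕ.+-mono-≤ (ℕ.m^n>0 2 n) (ℕ.≤-trans (n≤2^n n) (ℕ.m≤m+n (2 ^ n) 0))

-- Since `q ≤ n`, the quotient is at least 1 and the remainder is at most `n / q * q`; hence `n` is
-- at most twice that product.
double≤quotient*4 : ∀ n q .{{_ : NonZero q}} → q ≤ n → n * 2 ≤ (n / q) * (4 * q)
double≤quotient*4 n q q≤n = begin
  n * 2                           ≡⟨ cong (_* 2) (m≡m%n+[m/n]*n n q) ⟩
  (n % q + n / q * q) * 2         ≤⟨ ℕ.*-monoˡ-≤ 2 (ℕ.+-monoˡ-≤ _ (begin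
    n % q       ≤⟨ ℕ.<⇒≤ (m%n<n n q) ⟩
    q           ≡⟨ ℕ.*-identityˡ q ⟨
    1 * q       ≤⟨ ℕ.*-monoˡ-≤ q (m≥n⇒m/n>0 q≤n) ⟩
    n / q * q   ∎)) ⟩
  (n / q * q + n / q * q) * 2     ≡⟨ regroup (n / q) q ⟩
  n / q * (4 * q)                 ∎
  where
  open ≤-Reasoning
  regroup : ∀ a q → (a * q + a * q) * 2 ≡ a * (4 * q)
  regroup = solve-∀

-- Assembling the theorem.

-- The last inequality states that the length of `L` is at least 2 to the power `n / C`, with
-- `C = 2 ^ (d ^ (21 * d + 20))`, raised to the power `C` to stay within natural numbers.
theorem12 : (d : ℕ) → 2 ≤ d → (N : ℕ) → (H : Graph N) → Connected H → MaxDegree H d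
    → d ^ (d ^ (d ^ d)) < N → (U₊ U₋ : Subset N) → Disjoint U₊ U₋
    → Σ ℕ λ n → Σ (Graph n) λ G →
    N ≤ n × n ≤ (2 ^ (d ^ (21 * d + 20))) * N
    × MaxDegree≤ G (d * 2 ^ (d ^ (21 * d + 20)))
    × Σ (List (Subset n)) λ L → Unique L × All (IsMaximalBlowup G H U₊ U₋) L
    × 2 ^ n ≤ length L ^ (2 ^ (d ^ (21 * d + 20)))
theorem12 d 2≤d N H conn (Δ≤d , _) tower<N U₊ U₋ _ =
  N * 2 , G , ℕ.m≤m*n N 2 , size , Δ-bound
  , maximalCopies U₊ U₋ , maximalCopies-unique U₊ U₋ , maximalCopies-maximal U₊ U₋ , many
  where
  open ≤-Reasoning

  C = 2 ^ (d ^ (21 * d + 20))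
  Q = blockCost d

  4Q≤C : 4 * Q ≤ C
  4Q≤C = ℕ.≤-trans (4*blockCost≤d^8 2≤d) (d^8≤2^d^[21d+20] 2≤d)

  4Q≤N : 4 * Q ≤ N
  4Q≤N = ℕ.≤-trans (4*blockCost≤d^8 2≤d) (ℕ.≤-trans (d^8≤tower 2≤d) (ℕ.<⇒≤ tower<N))

  2≤Q : 2 ≤ Q
  2≤Q = ℕ.≤-trans (ℕ.m≤m+n 2 d) (ℕ.m≤m*n (2 + d) (suc d * suc d))

  8≤C : 8 ≤ C
  8≤C = ℕ.≤-trans (ℕ.*-monoʳ-≤ 4 2≤Q) 4Q≤C

  Q≤N : Q ≤ N
  Q≤N = ℕ.≤-trans (ℕ.m≤n*m Q 4) 4Q≤N

  -- As many blocks as the greedy choice is sure to find, each using up `Q` vertices of H.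
  b = N / Q

  blocks = apartFamily H Δ≤d (b * (2 + d)) (begin
    b * (2 + d) * (suc d * suc d)   ≡⟨ ℕ.*-assoc b (2 + d) (suc d * suc d) ⟩
    b * Q                           ≤⟨ m/n*n≤m N Q ⟩
    N                               ∎)

  open Construction H Δ≤d (Connected⇒∃nbr H (ℕ.≤-trans 2≤Q Q≤N) conn) b (proj₁ blocks) (proj₂ blocks)

  size : N * 2 ≤ C * N
  size = begin
    N * 2   ≡⟨ ℕ.*-comm N 2 ⟩
    2 * N   ≤⟨ ℕ.*-monoˡ-≤ N (ℕ.≤-trans (ℕ.m≤m+n 2 6) 8≤C) ⟩
    C * N   ∎

  Δ-bound : MaxDegree≤ G (d * C)
  Δ-bound x = begin
    deg G x               ≤⟨ Δ-G x ⟩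
    (d + (2 + d)) * 2     ≤⟨ ℕ.*-monoˡ-≤ 2 (ℕ.+-monoʳ-≤ d (ℕ.+-monoˡ-≤ d 2≤d)) ⟩
    -- The slack `d * 2` rounds 6d up to 8d, which matches `8≤C`.
    (d + (d + d)) * 2     ≤⟨ ℕ.m≤m+n _ (d * 2) ⟩
    (d + (d + d)) * 2 + d * 2   ≡⟨ regroup d ⟩
    d * 8                 ≤⟨ ℕ.*-monoʳ-≤ d 8≤C ⟩
    d * C                 ∎
    where
    regroup : ∀ d → (d + (d + d)) * 2 + d * 2 ≡ d * 8
    regroup = solve-∀

  many : 2 ^ (N * 2) ≤ length (maximalCopies U₊ U₋) ^ C
  many = begin
    2 ^ (N * 2)                           ≤⟨ ℕ.^-monoʳ-≤ 2 (double≤quotient*4 N Q Q≤N) ⟩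
    2 ^ (b * (4 * Q))                     ≤⟨ ℕ.^-monoʳ-≤ 2 (ℕ.*-monoʳ-≤ b 4Q≤C) ⟩
    2 ^ (b * C)                           ≡⟨ ℕ.^-*-assoc 2 b C ⟨
    (2 ^ b) ^ C                           ≡⟨ cong (_^ C) (length-maximalCopies U₊ U₋) ⟨
    length (maximalCopies U₊ U₋) ^ C      ∎
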